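{- For every integer $r\ge1$, the characteristic polynomial of the linear recurrence sequence $(d_n^{(r)})_{n\ge r}$ is $$q^{(r)}(x)=(x^2-x-1)^{2r-1}.$$ That is, writing $q^{(r)}(x)=\sum_{j=0}^{4r-2}c_j x^{4r-2-j}$, one has $\sum_{j=0}^{4r-2}c_j\, d_{n-j}^{(r)}=0$ for all $n\ge r+(4r-2)$.
   Context: $F_m$ denotes the Fibonacci numbers: $F_0=0$, $F_1=1$, $F_m=F_{m-1}+F_{m-2}$ for $m\ge 2$. ${n\brace k}$ denotes the Stirling number of the second kind (the number of partitions of an $n$-element set into exactly $k$ non-empty blocks). The Fibonacci-Fubini triangle has entries $\mathcal{F}(n,k)=F_{k+1}{n\brace k}$ for $n\ge1$, $1\le k\le n$. For $r\ge1$ the $r$th right-down diagonal sequence $(d_n^{(r)})_{n=r}^\infty$ is defined by $d_n^{(r)}=\mathcal{F}(n,n-r+1)=F_{n-r+2}{n\brace n-r+1}$. -}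

module Defs where

open import Data.Fin.Base using (Fin)
open import Data.Fin.Properties using (all?)
open import Data.Fin.Subset using (Subset; Nonempty; Empty; _∈_; _∩_; inside; outside)
open import Data.Fin.Subset.Properties using (nonempty?; _∈?_)
open import Data.Integer.Base as ℤ using (ℤ; +_; -[1+_]; 0ℤ; 1ℤ)
open import Data.List.Base using (List; []; _∷_; _++_; map; filter; foldr; applyUpTo; length)
open import Data.List.Relation.Unary.All as All using (All)
open import Data.List.Relation.Unary.AllPairs as AllPairs using (AllPairs)
open import Data.List.Relation.Unary.Any as Any using (Any)
open import Data.Nat.Base using (ℕ; zero; suc; _+_; _*_; _∸_; _≤_; _<_)
open import Data.Nat.Properties using (_≟_)
open import Data.Product.Base using (_×_)
open import Data.Vec.Base using ([]; _∷_)
open import Relation.Binary.PropositionalEquality.Core using (_≡_)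
open import Relation.Nullary.Decidable using (Dec; ¬?; _×-dec_)

F : ℕ → ℕ
F 0             = 0
F 1             = 1
F (suc (suc m)) = F (suc m) + F m

IsSetPartition : ∀ {n} → List (Subset n) → Set
IsSetPartition {n} P =
    All Nonempty P
  × AllPairs (λ A B → Empty (A ∩ B)) P
  × (∀ (i : Fin n) → Any (i ∈_) P)

isSetPartition? : ∀ {n} (P : List (Subset n)) → Dec (IsSetPartition P)
isSetPartition? P =
        All.all? nonempty? P
  ×-dec AllPairs.allPairs? (λ A B → ¬? (nonempty? (A ∩ B))) P
  ×-dec all? (λ i → Any.any? (i ∈?_) P)

subsets : ∀ n → List (Subset n)
subsets zero    = [] ∷ []
subsets (suc n) = map (outside ∷_) (subsets n) ++ map (inside ∷_) (subsets n)

sublists : ∀ {A : Set} → List A → List (List A)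
sublists []       = [] ∷ []
sublists (x ∷ xs) = sublists xs ++ map (x ∷_) (sublists xs)

-- Since `subsets n` lists every subset of Fin n exactly once, every set of
-- subsets of Fin n is represented by exactly one of its sublists.
setPartitions : ∀ n k → List (List (Subset n))
setPartitions n k =
  filter (λ P → (length P ≟ k) ×-dec isSetPartition? P) (sublists (subsets n))

-- Stirling numbers of the second kind.
S₂ : ℕ → ℕ → ℕ
S₂ n k = length (setPartitions n k)

𝓕 : ℕ → ℕ → ℕ
𝓕 n k = F (k + 1) * S₂ n k

-- Meaningful for n ≥ r only, where the truncated subtraction is exact.
d : ℕ → ℕ → ℕ
d r n = 𝓕 n (n ∸ r + 1)

-- Integer polynomials as coefficient lists, constant term first; trailing
-- zeros are allowed, so only `coeff` is meaningful, not the length.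
Poly : Set
Poly = List ℤ

coeff : Poly → ℕ → ℤ
coeff []      _       = 0ℤ
coeff (a ∷ p) zero    = a
coeff (a ∷ p) (suc i) = coeff p i

infixl 6 _+ₚ_
infixl 7 _*ₚ_
infixr 8 _^ₚ_

_+ₚ_ : Poly → Poly → Poly
[]      +ₚ q       = q
(a ∷ p) +ₚ []      = a ∷ p
(a ∷ p) +ₚ (b ∷ q) = (a ℤ.+ b) ∷ (p +ₚ q)

_*ₚ_ : Poly → Poly → Poly
[]      *ₚ q = []
(a ∷ p) *ₚ q = map (a ℤ.*_) q +ₚ (0ℤ ∷ (p *ₚ q))

_^ₚ_ : Poly → ℕ → Poly
p ^ₚ zero  = 1ℤ ∷ []
p ^ₚ suc k = p *ₚ (p ^ₚ k)

x²-x-1 : Poly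
x²-x-1 = -[1+ 0 ] ∷ -[1+ 0 ] ∷ 1ℤ ∷ []

-- f 0 + f 1 + ⋯ + f m
∑≤ : ℕ → (ℕ → ℤ) → ℤ
∑≤ m f = foldr ℤ._+_ 0ℤ (applyUpTo f (suc m))

-- q is monic of degree m, and with q = c₀ xᵐ + c₁ xᵐ⁻¹ + ⋯ + cₘ the sequence
-- (aₙ), n ≥ s, satisfies c₀ aₙ + c₁ aₙ₋₁ + ⋯ + cₘ aₙ₋ₘ = 0 for all n ≥ s + m.
record IsCharacteristicPolynomial (q : Poly) (m s : ℕ) (a : ℕ → ℤ) : Set where
  field
    leading    : coeff q m ≡ 1ℤ
    degree     : ∀ i → m < i → coeff q i ≡ 0ℤ
    recurrence : ∀ n → s + m ≤ n → ∑≤ m (λ j → coeff q (m ∸ j) ℤ.* a (n ∸ j)) ≡ 0ℤ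

{-# OPTIONS --safe #-}
-- Write r = s + 1 and g_s(t) = S₂ (t + s + 1) (t + 1), so that d_{r+t} = F (t+2) · g_s(t).
-- The Stirling recurrence reads Δ g_{s+1}(t) = (t+2) · g_s(t+1) with g_0 = 1, hence
-- Δ^{2s+1} g_s = 0 (g_s is a polynomial of degree 2s).  For a sequence u with
-- u_{t+2} = u_{t+1} + u_t and L = E² − E − 1 (E the shift), one has
-- L(u g) = (E²u)(E Δg) + u Δg: each application of L lowers the degree of the
-- polynomial factor by one, so L^{2s+1} annihilates F (t+2) · g_s(t).
module Submission where

open import Defs
open import Data.Bool.Base using (if_then_else_)
open import Data.Fin.Base using (zero; suc)
open import Data.Fin.Subset using (Subset; Nonempty; Empty; _∈_; _∩_; inside; outside)
open import Data.Fin.Subset.Properties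
  using (nonempty?; drop-there; drop-∷-Empty; ∩-comm; ∩-idem; x∈p∩q⁻)
open import Data.Integer.Base as ℤ using (ℤ; +_; 0ℤ; 1ℤ; -1ℤ)
import Data.Integer.Properties as ℤ
import Data.Integer.Tactic.RingSolver as ℤSolver
open import Data.List.Base using (List; []; _∷_; [_]; _++_; map; filter; foldr; applyUpTo; length)
open import Data.List.Properties using (map-∘; map-++; length-map)
open import Data.List.Relation.Binary.Permutation.Propositional
  using (_↭_; refl; prep; swap; trans; ↭-sym)
open import Data.List.Relation.Binary.Permutation.Propositional.Properties
  using (All-resp-↭; Any-resp-↭; ↭-length; ++-comm)
open import Data.List.Relation.Unary.All as All using (All; []; _∷_)
import Data.List.Relation.Unary.All.Properties as All
open import Data.List.Relation.Unary.AllPairs as AllPairs using (AllPairs; []; _∷_)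
import Data.List.Relation.Unary.AllPairs.Properties as AllPairs
open import Data.List.Relation.Unary.Any as Any using (Any; here; there)
import Data.List.Relation.Unary.Any.Properties as Any
open import Data.Nat.Base using (ℕ; zero; suc; _+_; _*_; _∸_; _≤_; _<_; z≤n; s≤s; s≤s⁻¹)
open import Data.Nat.ListAction using (sum)
open import Data.Nat.ListAction.Properties using (sum-++)
open import Data.Nat.Properties
  using (_≟_; +-comm; +-identityʳ; *-zeroʳ; *-identityʳ; suc-injective; m+n∸m≡n; n<1+n; m≤n⇒m≤1+n;
         m≤n⇒∃[o]m+o≡n; +-suc; +-assoc; +-∸-assoc)
import Data.Nat.Tactic.RingSolver as ℕSolver
open import Data.Product.Base using (_×_; _,_; proj₁)
open import Data.Vec.Base as Vec using (_∷_)
open import Function.Base using (_∘_; _$_)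
open import Function.Bundles using (_⇔_; mk⇔; Equivalence)
open import Relation.Binary.Definitions using (Symmetric; _Respects_)
open import Relation.Binary.PropositionalEquality as ≡
  using (_≡_; refl; sym; cong; cong₂; subst; module ≡-Reasoning)
open import Relation.Nullary.Decidable using (Dec; yes; no; does; does-⇔; dec-true; dec-false; ¬?; _×-dec_)
open import Relation.Nullary.Negation using (¬_; contradiction)

open ≡-Reasoning

-- Sums over lists and over sublists

private variable
  A B : Set

∑ : List A → (A → ℕ) → ℕ
∑ xs f = sum (map f xs)

∑-cong : ∀ {f g : A → ℕ} (xs : List A) → (∀ x → f x ≡ g x) → ∑ xs f ≡ ∑ xs g
∑-cong []       f≗g = refl
∑-cong (x ∷ xs) f≗g = cong₂ _+_ (f≗g x) (∑-cong xs f≗g)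

∑-zero : ∀ {f : A → ℕ} (xs : List A) → (∀ x → f x ≡ 0) → ∑ xs f ≡ 0
∑-zero []       f≗0 = refl
∑-zero (x ∷ xs) f≗0 = cong₂ _+_ (f≗0 x) (∑-zero xs f≗0)

∑-++ : ∀ (f : A → ℕ) xs ys → ∑ (xs ++ ys) f ≡ ∑ xs f + ∑ ys f
∑-++ f xs ys = ≡.trans (cong sum (map-++ f xs ys)) (sum-++ (map f xs) (map f ys))

∑-map : ∀ (f : B → ℕ) (g : A → B) xs → ∑ (map g xs) f ≡ ∑ xs (f ∘ g)
∑-map f g xs = cong sum (sym (map-∘ xs))

∑-+ : ∀ (f g : A → ℕ) xs → ∑ xs (λ x → f x + g x) ≡ ∑ xs f + ∑ xs g
∑-+ f g []       = refl
∑-+ f g (x ∷ xs) = begin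
  (f x + g x) + ∑ xs (λ y → f y + g y)  ≡⟨ cong (λ z → (f x + g x) + z) (∑-+ f g xs) ⟩
  (f x + g x) + (∑ xs f + ∑ xs g)       ≡⟨ lemma (f x) (g x) (∑ xs f) (∑ xs g) ⟩
  (f x + ∑ xs f) + (g x + ∑ xs g)       ∎
  where
  lemma : ∀ a b c e → (a + b) + (c + e) ≡ (a + c) + (b + e)
  lemma = ℕSolver.solve-∀

∑-*ˡ : ∀ c (f : A → ℕ) xs → ∑ xs (λ x → c * f x) ≡ c * ∑ xs f
∑-*ˡ c f []       = sym (*-zeroʳ c)
∑-*ˡ c f (x ∷ xs) = begin
  c * f x + ∑ xs (λ y → c * f y)  ≡⟨ cong (λ z → c * f x + z) (∑-*ˡ c f xs) ⟩
  c * f x + c * ∑ xs f            ≡⟨ lemma c (f x) (∑ xs f) ⟩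
  c * (f x + ∑ xs f)              ∎
  where
  lemma : ∀ a b e → a * b + a * e ≡ a * (b + e)
  lemma = ℕSolver.solve-∀

∑-sublists-∷ : ∀ (f : List A → ℕ) x xs →
  ∑ (sublists (x ∷ xs)) f ≡ ∑ (sublists xs) f + ∑ (sublists xs) (λ P → f (x ∷ P))
∑-sublists-∷ f x xs = ≡.trans
  (∑-++ f (sublists xs) (map (x ∷_) (sublists xs)))
  (cong (λ z → ∑ (sublists xs) f + z) (∑-map f (x ∷_) (sublists xs)))

∑-sublists-map : ∀ (f : List B → ℕ) (g : A → B) xs →
  ∑ (sublists (map g xs)) f ≡ ∑ (sublists xs) (λ P → f (map g P))
∑-sublists-map f g []       = refl
∑-sublists-map f g (x ∷ xs) = begin
  ∑ (sublists (g x ∷ map g xs)) f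
    ≡⟨ ∑-sublists-∷ f (g x) (map g xs) ⟩
  ∑ (sublists (map g xs)) f + ∑ (sublists (map g xs)) (λ P → f (g x ∷ P))
    ≡⟨ cong₂ _+_ (∑-sublists-map f g xs) (∑-sublists-map (λ P → f (g x ∷ P)) g xs) ⟩
  ∑ (sublists xs) (λ P → f (map g P)) + ∑ (sublists xs) (λ P → f (g x ∷ map g P))
    ≡⟨ ∑-sublists-∷ (λ P → f (map g P)) x xs ⟨
  ∑ (sublists (x ∷ xs)) (λ P → f (map g P)) ∎

-- A sublist of a concatenation splits uniquely into a sublist of each part; this separates the sets
-- avoiding 0 from those containing it.
∑-sublists-++ : ∀ (f : List A → ℕ) xs ys →
  ∑ (sublists (xs ++ ys)) f ≡ ∑ (sublists xs) (λ P → ∑ (sublists ys) (λ Q → f (P ++ Q)))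
∑-sublists-++ f []       ys = sym (+-identityʳ _)
∑-sublists-++ f (x ∷ xs) ys = begin
  ∑ (sublists (x ∷ xs ++ ys)) f
    ≡⟨ ∑-sublists-∷ f x (xs ++ ys) ⟩
  ∑ (sublists (xs ++ ys)) f + ∑ (sublists (xs ++ ys)) (λ P → f (x ∷ P))
    ≡⟨ cong₂ _+_ (∑-sublists-++ f xs ys) (∑-sublists-++ (λ P → f (x ∷ P)) xs ys) ⟩
  ∑ (sublists xs) h + ∑ (sublists xs) (λ P → h (x ∷ P))
    ≡⟨ ∑-sublists-∷ h x xs ⟨
  ∑ (sublists (x ∷ xs)) h ∎
  where
  h : List _ → ℕ
  h P = ∑ (sublists ys) (λ Q → f (P ++ Q))

∑-sublists-[] : ∀ (f : List A → ℕ) xs → (∀ x P → f (x ∷ P) ≡ 0) → ∑ (sublists xs) f ≡ f []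
∑-sublists-[] f []       f≗0 = +-identityʳ _
∑-sublists-[] f (x ∷ xs) f≗0 = begin
  ∑ (sublists (x ∷ xs)) f
    ≡⟨ ∑-sublists-∷ f x xs ⟩
  ∑ (sublists xs) f + ∑ (sublists xs) (λ P → f (x ∷ P))
    ≡⟨ cong₂ _+_ (∑-sublists-[] f xs f≗0) (∑-zero (sublists xs) (f≗0 x)) ⟩
  f [] + 0
    ≡⟨ +-identityʳ _ ⟩
  f [] ∎

-- The two vanishing hypotheses mirror a partition's treatment of one point: some block must contain
-- it, and no two blocks can.
∑-sublists-singletons : ∀ (f : List A → ℕ) xs → f [] ≡ 0 → (∀ x y P → f (x ∷ y ∷ P) ≡ 0) →
  ∑ (sublists xs) f ≡ ∑ xs (λ x → f [ x ])
∑-sublists-singletons f []       f[]≡0 f≗0 = cong (_+ 0) f[]≡0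
∑-sublists-singletons f (x ∷ xs) f[]≡0 f≗0 = begin
  ∑ (sublists (x ∷ xs)) f
    ≡⟨ ∑-sublists-∷ f x xs ⟩
  ∑ (sublists xs) f + ∑ (sublists xs) (λ P → f (x ∷ P))
    ≡⟨ cong₂ _+_ (∑-sublists-singletons f xs f[]≡0 f≗0) (∑-sublists-[] (λ P → f (x ∷ P)) xs (f≗0 x)) ⟩
  ∑ xs (λ y → f [ y ]) + f [ x ]
    ≡⟨ +-comm _ (f [ x ]) ⟩
  f [ x ] + ∑ xs (λ y → f [ y ]) ∎

-- Double counting of the pairs (b ∈ P, P) ↔ (b, P ∖ b); as f vanishes on lists with a
-- repeated element, the pairs with b ∈ P on the left contribute nothing.
∑-sublists-pointed : ∀ (f : List A → ℕ) xs →
  (∀ {P Q} → P ↭ Q → f P ≡ f Q) → (∀ x P → f (x ∷ x ∷ P) ≡ 0) →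
  ∑ (sublists xs) (λ P → ∑ xs (λ b → f (b ∷ P))) ≡ ∑ (sublists xs) (λ P → length P * f P)
∑-sublists-pointed f []       f-↭ f-dup = refl
∑-sublists-pointed f (x ∷ xs) f-↭ f-dup = begin
  ∑ (sublists (x ∷ xs)) (λ P → f (x ∷ P) + ∑ xs (λ b → f (b ∷ P)))
    ≡⟨ ∑-sublists-∷ _ x xs ⟩
  ∑ X (λ P → fx P + ∑ xs (λ b → f (b ∷ P))) +
  ∑ X (λ P → f (x ∷ x ∷ P) + ∑ xs (λ b → f (b ∷ x ∷ P)))
    ≡⟨ cong₂ _+_ (∑-+ fx _ X)
         (∑-cong X λ P → cong₂ _+_ (f-dup x P) (∑-cong xs λ b → f-↭ (swap b x refl))) ⟩
  (∑ X fx + ∑ X (λ P → ∑ xs (λ b → f (b ∷ P)))) + ∑ X (λ P → ∑ xs (λ b → fx (b ∷ P)))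
    ≡⟨ cong₂ _+_ (cong (λ z → ∑ X fx + z) (∑-sublists-pointed f xs f-↭ f-dup))
         (∑-sublists-pointed fx xs (f-↭ ∘ prep x) fx-dup) ⟩
  (∑ X fx + ∑ X (λ P → length P * f P)) + ∑ X (λ P → length P * fx P)
    ≡⟨ lemma (∑ X fx) _ _ ⟩
  ∑ X (λ P → length P * f P) + (∑ X fx + ∑ X (λ P → length P * fx P))
    ≡⟨ cong (λ z → ∑ X (λ P → length P * f P) + z) (∑-+ fx _ X) ⟨
  ∑ X (λ P → length P * f P) + ∑ X (λ P → suc (length P) * fx P)
    ≡⟨ ∑-sublists-∷ (λ P → length P * f P) x xs ⟨
  ∑ (sublists (x ∷ xs)) (λ P → length P * f P) ∎
  where
  X = sublists xs
  fx = λ P → f (x ∷ P)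
  fx-dup : ∀ y P → fx (y ∷ y ∷ P) ≡ 0
  fx-dup y P = ≡.trans (f-↭ (trans (swap x y refl) (prep y (swap x y refl)))) (f-dup y (x ∷ P))
  lemma : ∀ a b c → (a + b) + c ≡ b + (a + c)
  lemma = ℕSolver.solve-∀

-- Indicators of decidable propositions

ind : ∀ {P : Set} → Dec P → ℕ
ind p? = if does p? then 1 else 0

ind-⇔ : ∀ {P Q : Set} (p? : Dec P) (q? : Dec Q) → P ⇔ Q → ind p? ≡ ind q?
ind-⇔ p? q? P⇔Q = cong (if_then 1 else 0) (does-⇔ P⇔Q p? q?)

ind-yes : ∀ {P : Set} (p? : Dec P) → P → ind p? ≡ 1
ind-yes p? p = cong (if_then 1 else 0) (dec-true p? p)

ind-no : ∀ {P : Set} (p? : Dec P) → ¬ P → ind p? ≡ 0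
ind-no p? ¬p = cong (if_then 1 else 0) (dec-false p? ¬p)

-- Turns the count that defines `S₂` into a sum, to which the sublist identities apply.
length-filter≡∑ : ∀ {P : A → Set} (P? : ∀ x → Dec (P x)) xs →
  length (filter P? xs) ≡ ∑ xs (λ x → ind (P? x))
length-filter≡∑ P? []       = refl
length-filter≡∑ P? (x ∷ xs) with P? x
... | yes _ = cong suc (length-filter≡∑ P? xs)
... | no  _ = length-filter≡∑ P? xs

-- The recurrence of the Stirling numbers

private variable
  n : ℕ

Disjoint : Subset n → Subset n → Set
Disjoint p q = Empty (p ∩ q)

Disjoint-sym : Symmetric (Disjoint {n})
Disjoint-sym {x = p} {y = q} = subst Empty (∩-comm p q)

-- Symmetry serves the `swap` case, where the two leading elements are compared in the opposite
-- order.
AllPairs-resp-↭ : ∀ {R : A → A → Set} → Symmetric R → (AllPairs R) Respects _↭_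
AllPairs-resp-↭ R-sym refl         rs                     = rs
AllPairs-resp-↭ R-sym (prep x p)   (r ∷ rs)               = All-resp-↭ p r ∷ AllPairs-resp-↭ R-sym p rs
AllPairs-resp-↭ R-sym (swap x y p) ((xy ∷ r) ∷ (r′ ∷ rs)) =
  (R-sym xy ∷ All-resp-↭ p r′) ∷ (All-resp-↭ p r ∷ AllPairs-resp-↭ R-sym p rs)
AllPairs-resp-↭ R-sym (trans p q)  rs                     = AllPairs-resp-↭ R-sym q (AllPairs-resp-↭ R-sym p rs)

IsSetPartition-resp-↭ : IsSetPartition {n} Respects _↭_
IsSetPartition-resp-↭ p (ne , dis , cov) =
  All-resp-↭ p ne , AllPairs-resp-↭ Disjoint-sym p dis , λ i → Any-resp-↭ p (cov i)

Nonempty-out⁺ : ∀ {p : Subset n} → Nonempty p → Nonempty (outside ∷ p)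
Nonempty-out⁺ (i , i∈p) = suc i , Vec.there i∈p

Nonempty-out⁻ : ∀ {p : Subset n} → Nonempty (outside ∷ p) → Nonempty p
Nonempty-out⁻ (suc i , i∈p) = i , drop-there i∈p

-- Deletion of the point 0 before any case distinction on `b`. The block {0} ∪ b is nonempty
-- whatever `b` is, so the right side asks nonemptiness of `P` only.
extend-⇔ : ∀ (b : Subset n) P →
  IsSetPartition ((inside ∷ b) ∷ map (outside ∷_) P) ⇔
  (All Nonempty P × AllPairs Disjoint (b ∷ P) × (∀ i → Any (i ∈_) (b ∷ P)))
extend-⇔ b P = mk⇔ to from
  where
  to : _
  to (_ ∷ ne , b# ∷ dis , cov) =
      All.map Nonempty-out⁻ (All.map⁻ ne)
    , All.map drop-∷-Empty (All.map⁻ b#) ∷ AllPairs.map drop-∷-Empty (AllPairs.map⁻ dis)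
    , cover ∘ cov ∘ suc
    where
    cover : ∀ {i} → Any (suc i ∈_) ((inside ∷ b) ∷ map (outside ∷_) P) → Any (i ∈_) (b ∷ P)
    cover (here i∈b)  = here (drop-there i∈b)
    cover (there i∈P) = there (Any.map drop-there (Any.map⁻ i∈P))
  from : _
  from (ne , b# ∷ dis , cov) =
      (zero , Vec.here) ∷ All.map⁺ (All.map Nonempty-out⁺ ne)
    , All.map⁺ (All.map (_∘ Nonempty-out⁻) b#) ∷ AllPairs.map⁺ (AllPairs.map (_∘ Nonempty-out⁻) dis)
    , λ { zero    → here Vec.here
        ; (suc i) → cover (cov i) }
    where
    cover : ∀ {i} → Any (i ∈_) (b ∷ P) → Any (suc i ∈_) ((inside ∷ b) ∷ map (outside ∷_) P)
    cover (here i∈b)  = here (Vec.there i∈b)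
    cover (there i∈P) = there (Any.map⁺ (Any.map Vec.there i∈P))

-- The case in which 0 joins the block `b` of a partition of the other points.
insert-⇔ : ∀ {b : Subset n} {P} → Nonempty b →
  IsSetPartition ((inside ∷ b) ∷ map (outside ∷_) P) ⇔ IsSetPartition (b ∷ P)
insert-⇔ {b = b} {P} ne-b = mk⇔
  (λ sp → let ne , rest = to sp in ne-b ∷ ne , rest)
  (λ { (_ ∷ ne , rest) → from (ne , rest) })
  where open Equivalence (extend-⇔ b P)

singleton-⇔ : ∀ {b : Subset n} {P} → Empty b →
  IsSetPartition ((inside ∷ b) ∷ map (outside ∷_) P) ⇔ IsSetPartition P
singleton-⇔ {b = b} {P} e-b = mk⇔
  (λ sp → let ne , dis , cov = to sp in ne , AllPairs.tail dis , tail ∘ cov)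
  (λ { (ne , dis , cov) → from (ne , All.universal disjoint P ∷ dis , there ∘ cov) })
  where
  open Equivalence (extend-⇔ b P)
  tail : ∀ {i} → Any (i ∈_) (b ∷ P) → Any (i ∈_) P
  tail (here i∈b)  = contradiction (_ , i∈b) e-b
  tail (there i∈P) = i∈P
  disjoint : ∀ p → Disjoint b p
  disjoint p (i , i∈b∩p) = e-b (i , proj₁ (x∈p∩q⁻ b p i∈b∩p))

-- The very predicate by which `setPartitions` filters.
π? : ∀ k (P : List (Subset n)) → Dec (length P ≡ k × IsSetPartition P)
π? k P = (length P ≟ k) ×-dec isSetPartition? P

π : ℕ → List (Subset n) → ℕ
π k P = ind (π? k P)

S₂≡∑π : ∀ n k → S₂ n k ≡ ∑ (sublists (subsets n)) (π k)
S₂≡∑π n k = length-filter≡∑ (π? k) (sublists (subsets n))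

π-↭ : ∀ k {P Q : List (Subset n)} → P ↭ Q → π k P ≡ π k Q
π-↭ k {P} {Q} p = ind-⇔ (π? k P) (π? k Q) (mk⇔ (respects p) (respects (↭-sym p)))
  where
  respects : ∀ {P Q} → P ↭ Q → length P ≡ k × IsSetPartition P → length Q ≡ k × IsSetPartition Q
  respects p (len , sp) = ≡.trans (sym (↭-length p)) len , IsSetPartition-resp-↭ p sp

-- A repeated block would be disjoint from itself, hence empty.
π-dup : ∀ k (b : Subset n) P → π k (b ∷ b ∷ P) ≡ 0
π-dup k b P = ind-no (π? k (b ∷ b ∷ P))
  λ { (_ , ne ∷ _ , (b# ∷ _) ∷ _ , _) → subst Empty (∩-idem b) b# ne }

π-uncovered : ∀ k (P : List (Subset n)) → π k (map (outside ∷_) P) ≡ 0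
π-uncovered k P = ind-no (π? k (map (outside ∷_) P))
  λ { (_ , _ , _ , cov) → uncovered P (cov zero) }
  where
  uncovered : ∀ P → ¬ Any (zero ∈_) (map (outside ∷_) P)
  uncovered (_ ∷ P) (there any) = uncovered P any

π-overlap : ∀ k (b c : Subset n) P → π k ((inside ∷ b) ∷ (inside ∷ c) ∷ P) ≡ 0
π-overlap k b c P = ind-no (π? k ((inside ∷ b) ∷ (inside ∷ c) ∷ P))
  λ { (_ , _ , (bc ∷ _) ∷ _ , _) → bc (zero , Vec.here) }

empty : Subset n → ℕ
empty b = ind (¬? (nonempty? b))

-- At most one summand survives. For nonempty `b` the factor `empty b` is 0; for empty `b` the list
-- `b ∷ P` has an empty block, and removing {0} leaves `k` blocks.
π-extend : ∀ k (b : Subset n) P →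
  π (suc k) ((inside ∷ b) ∷ map (outside ∷_) P) ≡ π (suc k) (b ∷ P) + π k P * empty b
π-extend k b P = by-cases (nonempty? b)
  where
  by-cases : Dec (Nonempty b) →
    π (suc k) ((inside ∷ b) ∷ map (outside ∷_) P) ≡ π (suc k) (b ∷ P) + π k P * empty b
  by-cases (yes ne) = begin
    π (suc k) ((inside ∷ b) ∷ map (outside ∷_) P)
      ≡⟨ ind-⇔ (π? (suc k) _) (π? (suc k) _) (mk⇔
           (λ { (len , sp) → ≡.trans (cong suc (sym (length-map _ P))) len , to sp })
           (λ { (len , sp) → ≡.trans (cong suc (length-map _ P)) len , from sp })) ⟩
    π (suc k) (b ∷ P)
      ≡⟨ +-identityʳ _ ⟨
    π (suc k) (b ∷ P) + 0
      ≡⟨ cong (λ z → π (suc k) (b ∷ P) + z) (*-zeroʳ (π k P)) ⟨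
    π (suc k) (b ∷ P) + π k P * 0
      ≡⟨ cong (λ z → π (suc k) (b ∷ P) + π k P * z) (ind-no (¬? (nonempty? b)) (λ e → e ne)) ⟨
    π (suc k) (b ∷ P) + π k P * empty b ∎
    where open Equivalence (insert-⇔ {P = P} ne)
  by-cases (no e) = begin
    π (suc k) ((inside ∷ b) ∷ map (outside ∷_) P)
      ≡⟨ ind-⇔ (π? (suc k) _) (π? k P) (mk⇔
           (λ { (len , sp) → ≡.trans (sym (length-map _ P)) (suc-injective len) , to sp })
           (λ { (len , sp) → cong suc (≡.trans (length-map _ P) len) , from sp })) ⟩
    π k P
      ≡⟨ cong₂ _+_ (ind-no (π? (suc k) (b ∷ P)) λ { (_ , ne ∷ _ , _) → e ne }) (*-identityʳ (π k P)) ⟨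
    π (suc k) (b ∷ P) + π k P * 1
      ≡⟨ cong (λ z → π (suc k) (b ∷ P) + π k P * z) (ind-yes (¬? (nonempty? b)) e) ⟨
    π (suc k) (b ∷ P) + π k P * empty b ∎
    where open Equivalence (singleton-⇔ {P = P} e)

-- Adjoining `inside` destroys emptiness and adjoining `outside` preserves it, so the empty set is
-- listed exactly once.
∑-empty : ∀ n → ∑ (subsets n) empty ≡ 1
∑-empty zero    = refl
∑-empty (suc n) = begin
  ∑ (map (outside ∷_) X ++ map (inside ∷_) X) empty
    ≡⟨ ∑-++ empty (map (outside ∷_) X) (map (inside ∷_) X) ⟩
  ∑ (map (outside ∷_) X) empty + ∑ (map (inside ∷_) X) empty
    ≡⟨ cong₂ _+_ (∑-map empty (outside ∷_) X) (∑-map empty (inside ∷_) X) ⟩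
  ∑ X (λ b → empty (outside ∷ b)) + ∑ X (λ b → empty (inside ∷ b))
    ≡⟨ cong₂ _+_ (∑-cong X empty-out) (∑-zero X empty-in) ⟩
  ∑ X empty + 0
    ≡⟨ +-identityʳ _ ⟩
  ∑ X empty
    ≡⟨ ∑-empty n ⟩
  1 ∎
  where
  X = subsets n
  empty-in : ∀ (b : Subset n) → empty (inside ∷ b) ≡ 0
  empty-in b = ind-no (¬? (nonempty? (inside ∷ b))) (λ e → e (zero , Vec.here))
  empty-out : ∀ (b : Subset n) → empty (outside ∷ b) ≡ empty b
  empty-out b = ind-⇔ (¬? (nonempty? (outside ∷ b))) (¬? (nonempty? b))
    (mk⇔ (_∘ Nonempty-out⁺) (_∘ Nonempty-out⁻))

-- Where the length differs from `k`, the indicator vanishes on both sides.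
length*π : ∀ k (P : List (Subset n)) → length P * π k P ≡ k * π k P
length*π k P = by-cases (length P ≟ k)
  where
  by-cases : Dec (length P ≡ k) → length P * π k P ≡ k * π k P
  by-cases (yes len) = cong (_* π k P) len
  by-cases (no  len) = begin
    length P * π k P  ≡⟨ cong (length P *_) π≡0 ⟩
    length P * 0      ≡⟨ *-zeroʳ (length P) ⟩
    0                 ≡⟨ *-zeroʳ k ⟨
    k * 0             ≡⟨ cong (k *_) π≡0 ⟨
    k * π k P         ∎
    where
    π≡0 : π k P ≡ 0
    π≡0 = ind-no (π? k P) (len ∘ proj₁)

-- A sublist of subsets (suc n) consists of sets avoiding 0 and sets containing 0; in a
-- partition the latter form a single block {0} ∪ b, and b is either empty or a block of
-- the partition obtained by deleting 0.
S₂-suc-suc : ∀ n k → S₂ (suc n) (suc k) ≡ suc k * S₂ n (suc k) + S₂ n k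
S₂-suc-suc n k = begin
  S₂ (suc n) (suc k)
    ≡⟨ S₂≡∑π (suc n) (suc k) ⟩
  ∑ (sublists (map (outside ∷_) X ++ map (inside ∷_) X)) (π (suc k))
    ≡⟨ ∑-sublists-++ (π (suc k)) (map (outside ∷_) X) (map (inside ∷_) X) ⟩
  ∑ (sublists (map (outside ∷_) X)) (λ P → ∑ (sublists (map (inside ∷_) X)) λ Q → π (suc k) (P ++ Q))
    ≡⟨ ∑-sublists-map _ (outside ∷_) X ⟩
  ∑ (sublists X) (λ P → ∑ (sublists (map (inside ∷_) X)) λ Q → π (suc k) (map (outside ∷_) P ++ Q))
    ≡⟨ ∑-cong (sublists X) inner ⟩
  ∑ (sublists X) (λ P → ∑ X (λ b → π (suc k) (b ∷ P)) + π k P)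
    ≡⟨ ∑-+ _ (π k) (sublists X) ⟩
  ∑ (sublists X) (λ P → ∑ X (λ b → π (suc k) (b ∷ P))) + ∑ (sublists X) (π k)
    -- A partition of the other points arises once for each of its blocks that 0 may join.
    ≡⟨ cong₂ _+_ (∑-sublists-pointed (π (suc k)) X (π-↭ (suc k)) (π-dup (suc k))) refl ⟩
  ∑ (sublists X) (λ P → length P * π (suc k) P) + ∑ (sublists X) (π k)
    ≡⟨ cong₂ _+_ (∑-cong (sublists X) (length*π (suc k))) refl ⟩
  ∑ (sublists X) (λ P → suc k * π (suc k) P) + ∑ (sublists X) (π k)
    ≡⟨ cong₂ _+_ (∑-*ˡ (suc k) (π (suc k)) (sublists X)) refl ⟩
  suc k * ∑ (sublists X) (π (suc k)) + ∑ (sublists X) (π k)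
    ≡⟨ cong₂ (λ x y → suc k * x + y) (S₂≡∑π n (suc k)) (S₂≡∑π n k) ⟨
  suc k * S₂ n (suc k) + S₂ n k ∎
  where
  X = subsets n
  inner : ∀ P → ∑ (sublists (map (inside ∷_) X)) (λ Q → π (suc k) (map (outside ∷_) P ++ Q))
              ≡ ∑ X (λ b → π (suc k) (b ∷ P)) + π k P
  inner P = begin
    ∑ (sublists (map (inside ∷_) X)) (λ Q → π (suc k) (P′ ++ Q))
      ≡⟨ ∑-sublists-map _ (inside ∷_) X ⟩
    ∑ (sublists X) (λ Q → π (suc k) (P′ ++ map (inside ∷_) Q))
      -- The sets containing 0 move to the front, the shape for which `π-overlap` and `π-extend` are
      -- stated.
      ≡⟨ ∑-cong (sublists X) (λ Q → π-↭ (suc k) (++-comm P′ (map (inside ∷_) Q))) ⟩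
    ∑ (sublists X) (λ Q → π (suc k) (map (inside ∷_) Q ++ P′))
      ≡⟨ ∑-sublists-singletons _ X (π-uncovered (suc k) P)
           (λ b c Q → π-overlap (suc k) b c (map (inside ∷_) Q ++ P′)) ⟩
    ∑ X (λ b → π (suc k) ((inside ∷ b) ∷ P′))
      ≡⟨ ∑-cong X (λ b → π-extend k b P) ⟩
    ∑ X (λ b → π (suc k) (b ∷ P) + π k P * empty b)
      ≡⟨ ∑-+ _ _ X ⟩
    ∑ X (λ b → π (suc k) (b ∷ P)) + ∑ X (λ b → π k P * empty b)
      ≡⟨ cong (λ z → ∑ X (λ b → π (suc k) (b ∷ P)) + z) (∑-*ˡ (π k P) empty X) ⟩
    ∑ X (λ b → π (suc k) (b ∷ P)) + π k P * ∑ X empty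
      ≡⟨ cong (λ z → ∑ X (λ b → π (suc k) (b ∷ P)) + π k P * z) (∑-empty n) ⟩
    ∑ X (λ b → π (suc k) (b ∷ P)) + π k P * 1
      ≡⟨ cong (λ z → ∑ X (λ b → π (suc k) (b ∷ P)) + z) (*-identityʳ (π k P)) ⟩
    ∑ X (λ b → π (suc k) (b ∷ P)) + π k P ∎
    where P′ = map (outside ∷_) P

-- Boundary values of the Stirling numbers

S₂-zero-suc : ∀ k → S₂ 0 (suc k) ≡ 0
S₂-zero-suc k = ≡.trans (S₂≡∑π 0 (suc k)) (cong (_+ 0) (ind-no (π? (suc k) ([] ∷ []))
  λ { (_ , (() , _) ∷ _ , _) }))
  where open Vec using ([])

S₂-> : ∀ n k → n < k → S₂ n k ≡ 0
S₂-> zero    (suc k) _         = S₂-zero-suc k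
S₂-> (suc n) (suc k) (s≤s n<k) = begin
  S₂ (suc n) (suc k)             ≡⟨ S₂-suc-suc n k ⟩
  suc k * S₂ n (suc k) + S₂ n k  ≡⟨ cong₂ (λ x y → suc k * x + y) (S₂-> n (suc k) (m≤n⇒m≤1+n n<k)) (S₂-> n k n<k) ⟩
  suc k * 0 + 0                  ≡⟨ cong (_+ 0) (*-zeroʳ (suc k)) ⟩
  0                              ∎

S₂-diagonal : ∀ n → S₂ n n ≡ 1
S₂-diagonal zero    = refl
S₂-diagonal (suc n) = begin
  S₂ (suc n) (suc n)             ≡⟨ S₂-suc-suc n n ⟩
  suc n * S₂ n (suc n) + S₂ n n  ≡⟨ cong₂ (λ x y → suc n * x + y) (S₂-> n (suc n) (n<1+n n)) (S₂-diagonal n) ⟩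
  suc n * 0 + 1                  ≡⟨ cong (_+ 1) (*-zeroʳ (suc n)) ⟩
  1                              ∎

-- Polynomial sequences

Δ : (ℕ → ℤ) → ℕ → ℤ
Δ g t = g (suc t) ℤ.- g t

-- Degree less than k for polynomial sequences, characterised by Δᵏ g = 0.
Deg< : ℕ → (ℕ → ℤ) → Set
Deg< zero    g = ∀ t → g t ≡ 0ℤ
Deg< (suc k) g = Deg< k (Δ g)

Deg<-cong : ∀ k {g h} → (∀ t → g t ≡ h t) → Deg< k h → Deg< k g
Deg<-cong zero    g≗h dh t = ≡.trans (g≗h t) (dh t)
Deg<-cong (suc k) g≗h dh   = Deg<-cong k (λ t → cong₂ ℤ._-_ (g≗h (suc t)) (g≗h t)) dh

Deg<-+ : ∀ k {g h} → Deg< k g → Deg< k h → Deg< k (λ t → g t ℤ.+ h t)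
Deg<-+ zero            dg dh t = cong₂ ℤ._+_ (dg t) (dh t)
Deg<-+ (suc k) {g} {h} dg dh   =
  Deg<-cong k (λ t → lemma (g (suc t)) (h (suc t)) (g t) (h t)) (Deg<-+ k dg dh)
  where
  lemma : ∀ a b c e → (a ℤ.+ b) ℤ.- (c ℤ.+ e) ≡ (a ℤ.- c) ℤ.+ (b ℤ.- e)
  lemma = ℤSolver.solve-∀

-- `Δ` commutes definitionally with the shift, so the induction needs no rewriting.
Deg<-shift : ∀ k {g} → Deg< k g → Deg< k (g ∘ suc)
Deg<-shift zero    dg = dg ∘ suc
Deg<-shift (suc k) dg = Deg<-shift k dg

Deg<-suc : ∀ k {g} → Deg< k g → Deg< (suc k) g
Deg<-suc zero    dg t = cong₂ ℤ._-_ (dg (suc t)) (dg t)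
Deg<-suc (suc k) dg   = Deg<-suc k dg

-- Product rule: Δ((t + c) g) = (t + c) Δg + E g. Induction bounds the first term, shift invariance
-- the second.
Deg<-linear* : ∀ k c {g} → Deg< k g → Deg< (suc k) (λ t → (+ t ℤ.+ c) ℤ.* g t)
Deg<-linear* zero    c {g} dg = Deg<-suc 0 {λ t → (+ t ℤ.+ c) ℤ.* g t} λ t →
  ≡.trans (cong ((+ t ℤ.+ c) ℤ.*_) (dg t)) (ℤ.*-zeroʳ (+ t ℤ.+ c))
Deg<-linear* (suc k) c {g} dg =
  Deg<-cong (suc k) (λ t → lemma (+ t) c (g (suc t)) (g t))
    (Deg<-+ (suc k) {λ t → (+ t ℤ.+ c) ℤ.* Δ g t} {g ∘ suc}
       (Deg<-linear* k c dg) (Deg<-shift (suc k) {g} dg))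
  where
  lemma : ∀ t c a b → ((1ℤ ℤ.+ t) ℤ.+ c) ℤ.* a ℤ.- (t ℤ.+ c) ℤ.* b ≡ (t ℤ.+ c) ℤ.* (a ℤ.- b) ℤ.+ a
  lemma = ℤSolver.solve-∀

-- The sequence g_s, integer-valued so that differences can be taken. The order `t + s` lets a step
-- in `t` reduce by computation.
S₂-offset : ℕ → ℕ → ℤ
S₂-offset s t = + S₂ (suc (t + s)) (suc t)

-- The last term of the Stirling recurrence is `S₂-offset (suc s) t` itself, so subtracting it
-- leaves only the multiple of an entry one diagonal earlier.
S₂-offset-Δ : ∀ s t → Δ (S₂-offset (suc s)) t ≡ (+ t ℤ.+ + 2) ℤ.* S₂-offset s (suc t)
S₂-offset-Δ s t = begin
  + S₂ (suc N) (2 + t) ℤ.- + S₂ N (suc t)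
    ≡⟨ cong (λ z → + z ℤ.- + S₂ N (suc t)) (S₂-suc-suc N (suc t)) ⟩
  + ((2 + t) * S₂ N (2 + t) + S₂ N (suc t)) ℤ.- + S₂ N (suc t)
    ≡⟨ cong (λ z → z ℤ.+ + S₂ N (suc t) ℤ.- + S₂ N (suc t)) (ℤ.pos-* (2 + t) (S₂ N (2 + t))) ⟩
  + (2 + t) ℤ.* + S₂ N (2 + t) ℤ.+ + S₂ N (suc t) ℤ.- + S₂ N (suc t)
    ≡⟨ lemma (+ t) (+ S₂ N (2 + t)) (+ S₂ N (suc t)) ⟩
  (+ t ℤ.+ + 2) ℤ.* + S₂ N (2 + t)
    ≡⟨ cong (λ m → (+ t ℤ.+ + 2) ℤ.* + S₂ (suc m) (2 + t)) (+-suc t s) ⟩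
  (+ t ℤ.+ + 2) ℤ.* S₂-offset s (suc t) ∎
  where
  N = suc (t + suc s)
  lemma : ∀ t a b → (+ 2 ℤ.+ t) ℤ.* a ℤ.+ b ℤ.- b ≡ (t ℤ.+ + 2) ℤ.* a
  lemma = ℤSolver.solve-∀

-- Each new diagonal raises the degree by two: one for the linear factor, one for undoing `Δ`.
S₂-offset-Deg< : ∀ s → Deg< (suc (s * 2)) (S₂-offset s)
S₂-offset-Deg< zero    t = cong₂ ℤ._-_ (diagonal (suc t)) (diagonal t)
  where
  diagonal : ∀ t → S₂-offset 0 t ≡ 1ℤ
  diagonal t = cong +_ (≡.trans (cong (λ m → S₂ (suc m) (suc t)) (+-identityʳ t)) (S₂-diagonal (suc t)))
S₂-offset-Deg< (suc s)   = Deg<-cong (suc (suc (s * 2))) (S₂-offset-Δ s)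
  (Deg<-linear* (suc (s * 2)) (+ 2) {S₂-offset s ∘ suc}
    (Deg<-shift (suc (s * 2)) {S₂-offset s} (S₂-offset-Deg< s)))

-- Polynomials in the shift operator

shift : ℕ → (ℕ → ℤ) → ℕ → ℤ
shift i a j = a (i + j)

-- (c₀ + c₁ E + c₂ E² + ⋯) a evaluated at 0, where E is the shift.
apply : Poly → (ℕ → ℤ) → ℤ
apply []      a = 0ℤ
apply (c ∷ p) a = c ℤ.* a 0 ℤ.+ apply p (a ∘ suc)

apply-cong : ∀ p {a b} → (∀ t → a t ≡ b t) → apply p a ≡ apply p b
apply-cong []      a≗b = refl
apply-cong (c ∷ p) a≗b = cong₂ (λ x y → c ℤ.* x ℤ.+ y) (a≗b 0) (apply-cong p (a≗b ∘ suc))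

apply-+ : ∀ p a b → apply p (λ t → a t ℤ.+ b t) ≡ apply p a ℤ.+ apply p b
apply-+ []      a b = refl
apply-+ (c ∷ p) a b = begin
  c ℤ.* (a 0 ℤ.+ b 0) ℤ.+ apply p (λ t → a (suc t) ℤ.+ b (suc t))
    ≡⟨ cong (λ z → c ℤ.* (a 0 ℤ.+ b 0) ℤ.+ z) (apply-+ p (a ∘ suc) (b ∘ suc)) ⟩
  c ℤ.* (a 0 ℤ.+ b 0) ℤ.+ (apply p (a ∘ suc) ℤ.+ apply p (b ∘ suc))
    ≡⟨ lemma c (a 0) (b 0) _ _ ⟩
  (c ℤ.* a 0 ℤ.+ apply p (a ∘ suc)) ℤ.+ (c ℤ.* b 0 ℤ.+ apply p (b ∘ suc)) ∎
  where
  lemma : ∀ c x y u v → c ℤ.* (x ℤ.+ y) ℤ.+ (u ℤ.+ v) ≡ (c ℤ.* x ℤ.+ u) ℤ.+ (c ℤ.* y ℤ.+ v)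
  lemma = ℤSolver.solve-∀

apply-+ₚ : ∀ p q a → apply (p +ₚ q) a ≡ apply p a ℤ.+ apply q a
apply-+ₚ []      q       a = sym (ℤ.+-identityˡ _)
apply-+ₚ (c ∷ p) []      a = sym (ℤ.+-identityʳ _)
apply-+ₚ (c ∷ p) (e ∷ q) a = begin
  (c ℤ.+ e) ℤ.* a 0 ℤ.+ apply (p +ₚ q) (a ∘ suc)
    ≡⟨ cong (λ z → (c ℤ.+ e) ℤ.* a 0 ℤ.+ z) (apply-+ₚ p q (a ∘ suc)) ⟩
  (c ℤ.+ e) ℤ.* a 0 ℤ.+ (apply p (a ∘ suc) ℤ.+ apply q (a ∘ suc))
    ≡⟨ lemma c e (a 0) _ _ ⟩
  (c ℤ.* a 0 ℤ.+ apply p (a ∘ suc)) ℤ.+ (e ℤ.* a 0 ℤ.+ apply q (a ∘ suc)) ∎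
  where
  lemma : ∀ c e x u v → (c ℤ.+ e) ℤ.* x ℤ.+ (u ℤ.+ v) ≡ (c ℤ.* x ℤ.+ u) ℤ.+ (e ℤ.* x ℤ.+ v)
  lemma = ℤSolver.solve-∀

apply-scale : ∀ c p a → apply (map (c ℤ.*_) p) a ≡ c ℤ.* apply p a
apply-scale c []      a = sym (ℤ.*-zeroʳ c)
apply-scale c (e ∷ p) a = begin
  (c ℤ.* e) ℤ.* a 0 ℤ.+ apply (map (c ℤ.*_) p) (a ∘ suc)
    ≡⟨ cong (λ z → (c ℤ.* e) ℤ.* a 0 ℤ.+ z) (apply-scale c p (a ∘ suc)) ⟩
  (c ℤ.* e) ℤ.* a 0 ℤ.+ c ℤ.* apply p (a ∘ suc)
    ≡⟨ lemma c e (a 0) _ ⟩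
  c ℤ.* (e ℤ.* a 0 ℤ.+ apply p (a ∘ suc)) ∎
  where
  lemma : ∀ c e x u → (c ℤ.* e) ℤ.* x ℤ.+ c ℤ.* u ≡ c ℤ.* (e ℤ.* x ℤ.+ u)
  lemma = ℤSolver.solve-∀

-- A product of polynomials acts as a composition of operators; `apply q (shift i a)` is the value
-- at `i` of the sequence obtained from `a` by the inner operator.
apply-*ₚ : ∀ p q a → apply (p *ₚ q) a ≡ apply p (λ i → apply q (shift i a))
apply-*ₚ []      q a = refl
apply-*ₚ (c ∷ p) q a = begin
  apply (map (c ℤ.*_) q +ₚ (0ℤ ∷ p *ₚ q)) a
    ≡⟨ apply-+ₚ (map (c ℤ.*_) q) (0ℤ ∷ p *ₚ q) a ⟩
  apply (map (c ℤ.*_) q) a ℤ.+ (0ℤ ℤ.+ apply (p *ₚ q) (a ∘ suc))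
    ≡⟨ cong₂ ℤ._+_ (apply-scale c q a) (≡.trans (ℤ.+-identityˡ _) (apply-*ₚ p q (a ∘ suc))) ⟩
  c ℤ.* apply q a ℤ.+ apply p (λ i → apply q (shift (suc i) a)) ∎

apply-x²-x-1 : ∀ a → apply x²-x-1 a ≡ a 2 ℤ.+ (-1ℤ ℤ.* a 1 ℤ.+ -1ℤ ℤ.* a 0)
apply-x²-x-1 a = lemma (a 0) (a 1) (a 2)
  where
  lemma : ∀ x y z → -1ℤ ℤ.* x ℤ.+ (-1ℤ ℤ.* y ℤ.+ (1ℤ ℤ.* z ℤ.+ 0ℤ)) ≡ z ℤ.+ (-1ℤ ℤ.* y ℤ.+ -1ℤ ℤ.* x)
  lemma = ℤSolver.solve-∀

apply-* : ∀ c p a → apply p (λ t → c ℤ.* a t) ≡ c ℤ.* apply p a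
apply-* c []      a = sym (ℤ.*-zeroʳ c)
apply-* c (e ∷ p) a = begin
  e ℤ.* (c ℤ.* a 0) ℤ.+ apply p (λ t → c ℤ.* a (suc t))
    ≡⟨ cong (λ z → e ℤ.* (c ℤ.* a 0) ℤ.+ z) (apply-* c p (a ∘ suc)) ⟩
  e ℤ.* (c ℤ.* a 0) ℤ.+ c ℤ.* apply p (a ∘ suc)
    ≡⟨ lemma c e (a 0) _ ⟩
  c ℤ.* (e ℤ.* a 0 ℤ.+ apply p (a ∘ suc)) ∎
  where
  lemma : ∀ c e x u → e ℤ.* (c ℤ.* x) ℤ.+ c ℤ.* u ≡ c ℤ.* (e ℤ.* x ℤ.+ u)
  lemma = ℤSolver.solve-∀

-- Linearity of `apply q` swaps the two operators: E² - E - 1 acts first, on the sequence itself,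
-- leaving a smaller power for induction.
apply-x²-x-1-* : ∀ q a → apply (x²-x-1 *ₚ q) a ≡
  apply q (λ t → a (2 + t) ℤ.+ (-1ℤ ℤ.* a (1 + t) ℤ.+ -1ℤ ℤ.* a t))
apply-x²-x-1-* q a = begin
  apply (x²-x-1 *ₚ q) a
    ≡⟨ apply-*ₚ x²-x-1 q a ⟩
  apply x²-x-1 (λ i → apply q (shift i a))
    ≡⟨ apply-x²-x-1 (λ i → apply q (shift i a)) ⟩
  apply q (shift 2 a) ℤ.+ (-1ℤ ℤ.* apply q (shift 1 a) ℤ.+ -1ℤ ℤ.* apply q a)
    ≡⟨ cong (λ z → apply q (shift 2 a) ℤ.+ z) (cong₂ ℤ._+_ (apply-* -1ℤ q (shift 1 a)) (apply-* -1ℤ q a)) ⟨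
  apply q (shift 2 a) ℤ.+ (apply q (λ t → -1ℤ ℤ.* a (1 + t)) ℤ.+ apply q (λ t → -1ℤ ℤ.* a t))
    ≡⟨ cong (λ z → apply q (shift 2 a) ℤ.+ z) (apply-+ q _ _) ⟨
  apply q (shift 2 a) ℤ.+ apply q (λ t → -1ℤ ℤ.* a (1 + t) ℤ.+ -1ℤ ℤ.* a t)
    ≡⟨ apply-+ q _ _ ⟨
  apply q (λ t → a (2 + t) ℤ.+ (-1ℤ ℤ.* a (1 + t) ℤ.+ -1ℤ ℤ.* a t)) ∎

FibonacciLike : (ℕ → ℤ) → Set
FibonacciLike u = ∀ t → u (2 + t) ≡ u (1 + t) ℤ.+ u t

-- Induction on `k` with `u` and `g` arbitrary: the product rule yields two products of the same
-- kind, since E²u is again Fibonacci-like and each polynomial factor has lost one degree.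
apply-annihilates : ∀ k u g → FibonacciLike u → Deg< k g →
  apply (x²-x-1 ^ₚ k) (λ t → u t ℤ.* g t) ≡ 0ℤ
apply-annihilates zero    u g fib dg = begin
  1ℤ ℤ.* (u 0 ℤ.* g 0) ℤ.+ 0ℤ  ≡⟨ cong (λ z → 1ℤ ℤ.* (u 0 ℤ.* z) ℤ.+ 0ℤ) (dg 0) ⟩
  1ℤ ℤ.* (u 0 ℤ.* 0ℤ) ℤ.+ 0ℤ   ≡⟨ lemma (u 0) ⟩
  0ℤ                           ∎
  where
  lemma : ∀ x → 1ℤ ℤ.* (x ℤ.* 0ℤ) ℤ.+ 0ℤ ≡ 0ℤ
  lemma = ℤSolver.solve-∀
apply-annihilates (suc k) u g fib dg = begin
  apply (x²-x-1 *ₚ q) (λ t → u t ℤ.* g t)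
    ≡⟨ apply-x²-x-1-* q (λ t → u t ℤ.* g t) ⟩
  apply q (λ t → u (2 + t) ℤ.* g (2 + t) ℤ.+ (-1ℤ ℤ.* (u (1 + t) ℤ.* g (1 + t)) ℤ.+ -1ℤ ℤ.* (u t ℤ.* g t)))
    ≡⟨ apply-cong q product-rule ⟩
  apply q (λ t → u (2 + t) ℤ.* Δ g (1 + t) ℤ.+ u t ℤ.* Δ g t)
    ≡⟨ apply-+ q _ _ ⟩
  apply q (λ t → u (2 + t) ℤ.* Δ g (1 + t)) ℤ.+ apply q (λ t → u t ℤ.* Δ g t)
    ≡⟨ cong₂ ℤ._+_
         (apply-annihilates k (shift 2 u) (Δ g ∘ suc) (λ t → fib (2 + t)) (Deg<-shift k dg))
         (apply-annihilates k u (Δ g) fib dg) ⟩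
  0ℤ ∎
  where
  q = x²-x-1 ^ₚ k
  lemma : ∀ u₀ u₁ g₀ g₁ g₂ →
    (u₁ ℤ.+ u₀) ℤ.* g₂ ℤ.+ (-1ℤ ℤ.* (u₁ ℤ.* g₁) ℤ.+ -1ℤ ℤ.* (u₀ ℤ.* g₀)) ≡
    (u₁ ℤ.+ u₀) ℤ.* (g₂ ℤ.- g₁) ℤ.+ u₀ ℤ.* (g₁ ℤ.- g₀)
  lemma = ℤSolver.solve-∀
  product-rule : ∀ t →
    u (2 + t) ℤ.* g (2 + t) ℤ.+ (-1ℤ ℤ.* (u (1 + t) ℤ.* g (1 + t)) ℤ.+ -1ℤ ℤ.* (u t ℤ.* g t)) ≡
    u (2 + t) ℤ.* Δ g (1 + t) ℤ.+ u t ℤ.* Δ g t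
  -- With `u (2 + t)` expanded this is a ring identity; it amounts to replacing `u (1 + t)` by the
  -- difference of `u (2 + t)` and `u t`.
  product-rule t rewrite fib t = lemma (u t) (u (1 + t)) (g t) (g (1 + t)) (g (2 + t))

-- Coefficients

coeff-+ₚ : ∀ p q i → coeff (p +ₚ q) i ≡ coeff p i ℤ.+ coeff q i
coeff-+ₚ []      q       i       = sym (ℤ.+-identityˡ _)
coeff-+ₚ (c ∷ p) []      i       = sym (ℤ.+-identityʳ _)
coeff-+ₚ (c ∷ p) (e ∷ q) zero    = refl
coeff-+ₚ (c ∷ p) (e ∷ q) (suc i) = coeff-+ₚ p q i

coeff-scale : ∀ c p i → coeff (map (c ℤ.*_) p) i ≡ c ℤ.* coeff p i
coeff-scale c []      i       = sym (ℤ.*-zeroʳ c)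
coeff-scale c (e ∷ p) zero    = refl
coeff-scale c (e ∷ p) (suc i) = coeff-scale c p i

-- Indices from 2 on avoid the boundary cases in which x² p contributes nothing.
coeff-x²-x-1-* : ∀ p i → coeff (x²-x-1 *ₚ p) (2 + i) ≡
  coeff p i ℤ.+ (-1ℤ ℤ.* coeff p (1 + i) ℤ.+ -1ℤ ℤ.* coeff p (2 + i))
coeff-x²-x-1-* p i = begin
  coeff (p₀ +ₚ (0ℤ ∷ p₀ +ₚ (0ℤ ∷ p₂))) (2 + i)
    ≡⟨ coeff-+ₚ p₀ _ (2 + i) ⟩
  coeff p₀ (2 + i) ℤ.+ coeff (p₀ +ₚ (0ℤ ∷ p₂)) (1 + i)
    ≡⟨ cong₂ ℤ._+_ (coeff-scale -1ℤ p (2 + i)) (coeff-+ₚ p₀ (0ℤ ∷ p₂) (1 + i)) ⟩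
  -1ℤ ℤ.* coeff p (2 + i) ℤ.+ (coeff p₀ (1 + i) ℤ.+ coeff p₂ i)
    ≡⟨ cong (λ z → -1ℤ ℤ.* coeff p (2 + i) ℤ.+ z) (cong₂ ℤ._+_ (coeff-scale -1ℤ p (1 + i))
         (≡.trans (coeff-+ₚ (map (1ℤ ℤ.*_) p) (0ℤ ∷ []) i)
                  (cong₂ ℤ._+_ (coeff-scale 1ℤ p i) (coeff-0 i)))) ⟩
  -1ℤ ℤ.* coeff p (2 + i) ℤ.+ (-1ℤ ℤ.* coeff p (1 + i) ℤ.+ (1ℤ ℤ.* coeff p i ℤ.+ 0ℤ))
    ≡⟨ lemma (coeff p i) (coeff p (1 + i)) (coeff p (2 + i)) ⟩
  coeff p i ℤ.+ (-1ℤ ℤ.* coeff p (1 + i) ℤ.+ -1ℤ ℤ.* coeff p (2 + i)) ∎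
  where
  p₀ = map (-1ℤ ℤ.*_) p
  -- The summand `0ℤ ∷ []` is what `*ₚ` leaves once its left factor is exhausted.
  p₂ = map (1ℤ ℤ.*_) p +ₚ (0ℤ ∷ [])
  coeff-0 : ∀ i → coeff (0ℤ ∷ []) i ≡ 0ℤ
  coeff-0 zero    = refl
  coeff-0 (suc i) = refl
  lemma : ∀ x y z → -1ℤ ℤ.* z ℤ.+ (-1ℤ ℤ.* y ℤ.+ (1ℤ ℤ.* x ℤ.+ 0ℤ)) ≡ x ℤ.+ (-1ℤ ℤ.* y ℤ.+ -1ℤ ℤ.* z)
  lemma = ℤSolver.solve-∀

^ₚ-degree : ∀ k i → k * 2 < i → coeff (x²-x-1 ^ₚ k) i ≡ 0ℤ
^ₚ-degree zero    (suc i)       _               = refl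
^ₚ-degree (suc k) (suc (suc i)) (s≤s (s≤s k<i)) = begin
  coeff (x²-x-1 *ₚ q) (2 + i)
    ≡⟨ coeff-x²-x-1-* q i ⟩
  coeff q i ℤ.+ (-1ℤ ℤ.* coeff q (1 + i) ℤ.+ -1ℤ ℤ.* coeff q (2 + i))
    ≡⟨ cong₂ ℤ._+_ (^ₚ-degree k i k<i) (cong₂ (λ x y → -1ℤ ℤ.* x ℤ.+ -1ℤ ℤ.* y)
         (^ₚ-degree k (1 + i) (m≤n⇒m≤1+n k<i))
         (^ₚ-degree k (2 + i) (m≤n⇒m≤1+n (m≤n⇒m≤1+n k<i)))) ⟩
  0ℤ ∎
  where q = x²-x-1 ^ₚ k

-- Only x² carries a coefficient to the top; the other two terms read `q` beyond its degree.
^ₚ-leading : ∀ k → coeff (x²-x-1 ^ₚ k) (k * 2) ≡ 1ℤ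
^ₚ-leading zero    = refl
^ₚ-leading (suc k) = begin
  coeff (x²-x-1 *ₚ q) (2 + k * 2)
    ≡⟨ coeff-x²-x-1-* q (k * 2) ⟩
  coeff q (k * 2) ℤ.+ (-1ℤ ℤ.* coeff q (1 + k * 2) ℤ.+ -1ℤ ℤ.* coeff q (2 + k * 2))
    ≡⟨ cong₂ ℤ._+_ (^ₚ-leading k) (cong₂ (λ x y → -1ℤ ℤ.* x ℤ.+ -1ℤ ℤ.* y)
         (^ₚ-degree k (1 + k * 2) (n<1+n _))
         (^ₚ-degree k (2 + k * 2) (m≤n⇒m≤1+n (n<1+n _)))) ⟩
  1ℤ ∎
  where q = x²-x-1 ^ₚ k

-- The recurrence sum as a polynomial in the shift

∑< : ℕ → (ℕ → ℤ) → ℤ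
∑< m f = foldr ℤ._+_ 0ℤ (applyUpTo f m)

∑<-cong : ∀ m {f g} → (∀ i → i < m → f i ≡ g i) → ∑< m f ≡ ∑< m g
∑<-cong zero    f≗g = refl
∑<-cong (suc m) f≗g = cong₂ ℤ._+_ (f≗g 0 (s≤s z≤n)) (∑<-cong m λ i i<m → f≗g (suc i) (s≤s i<m))

∑<-last : ∀ m f → ∑< (suc m) f ≡ f m ℤ.+ ∑< m f
∑<-last zero    f = refl
∑<-last (suc m) f = begin
  f 0 ℤ.+ ∑< (suc m) (f ∘ suc)            ≡⟨ cong (λ z → f 0 ℤ.+ z) (∑<-last m (f ∘ suc)) ⟩
  f 0 ℤ.+ (f (suc m) ℤ.+ ∑< m (f ∘ suc))  ≡⟨ lemma (f 0) (f (suc m)) _ ⟩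
  f (suc m) ℤ.+ (f 0 ℤ.+ ∑< m (f ∘ suc))  ∎
  where
  lemma : ∀ x y z → x ℤ.+ (y ℤ.+ z) ≡ y ℤ.+ (x ℤ.+ z)
  lemma = ℤSolver.solve-∀

∑≤-reverse : ∀ m f → ∑≤ m (λ j → f (m ∸ j)) ≡ ∑≤ m f
∑≤-reverse zero    f = refl
∑≤-reverse (suc m) f = begin
  f (suc m) ℤ.+ ∑≤ m (λ j → f (m ∸ j))  ≡⟨ cong (λ z → f (suc m) ℤ.+ z) (∑≤-reverse m f) ⟩
  -- `∑≤ m` is definitionally `∑< (suc m)`.
  f (suc m) ℤ.+ ∑≤ m f                  ≡⟨ ∑<-last (suc m) f ⟨
  ∑≤ (suc m) f                          ∎

-- The list `p` may be longer or shorter than `m`: entries from index `m` on vanish by hypothesis,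
-- and indices past its end read the default `0ℤ`.
∑<-coeff : ∀ m p a → (∀ i → m ≤ i → coeff p i ≡ 0ℤ) → ∑< m (λ i → coeff p i ℤ.* a i) ≡ apply p a
∑<-coeff zero    []      a deg = refl
∑<-coeff zero    (c ∷ p) a deg = begin
  0ℤ                               ≡⟨ cong₂ (λ x y → x ℤ.* a 0 ℤ.+ y) (deg 0 z≤n)
                                        (sym (∑<-coeff zero p (a ∘ suc) λ i _ → deg (suc i) z≤n)) ⟨
  c ℤ.* a 0 ℤ.+ apply p (a ∘ suc)  ∎
∑<-coeff (suc m) []      a deg = cong (λ z → 0ℤ ℤ.+ z) (∑<-coeff m [] (a ∘ suc) λ _ _ → refl)
∑<-coeff (suc m) (c ∷ p) a deg =
  cong (λ z → c ℤ.* a 0 ℤ.+ z) (∑<-coeff m p (a ∘ suc) λ i m≤i → deg (suc i) (s≤s m≤i))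

-- The diagonal sequences

d-diagonal : ∀ s t → + d (suc s) (suc s + t) ≡ + F (2 + t) ℤ.* S₂-offset s t
d-diagonal s t = begin
  + (F (s + t ∸ s + 1 + 1) * S₂ (suc (s + t)) (s + t ∸ s + 1))
    ≡⟨ cong (λ m → + (F (m + 1 + 1) * S₂ (suc (s + t)) (m + 1))) (m+n∸m≡n s t) ⟩
  + (F (t + 1 + 1) * S₂ (suc (s + t)) (t + 1))
    ≡⟨ cong (λ m → + (F (m + 1) * S₂ (suc (s + t)) m)) (+-comm t 1) ⟩
  + (F (suc t + 1) * S₂ (suc (s + t)) (suc t))
    ≡⟨ cong₂ (λ x y → + (F x * S₂ (suc y) (suc t))) (+-comm (suc t) 1) (+-comm s t) ⟩
  + (F (2 + t) * S₂ (suc (t + s)) (suc t))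
    ≡⟨ ℤ.pos-* (F (2 + t)) _ ⟩
  + F (2 + t) ℤ.* S₂-offset s t ∎

d-recurrence : ∀ s n → let k = suc (s * 2); m = k * 2 in suc s + m ≤ n →
  ∑≤ m (λ j → coeff (x²-x-1 ^ₚ k) (m ∸ j) ℤ.* + d (suc s) (n ∸ j)) ≡ 0ℤ
d-recurrence s n s+m≤n with m≤n⇒∃[o]m+o≡n s+m≤n
-- The terms involved run from index `r + t` up to `r + m + t`.
... | t , refl = begin
  ∑≤ m (λ j → coeff q (m ∸ j) ℤ.* + d r (r + m + t ∸ j))
    ≡⟨ ∑<-cong (suc m) (λ j j≤m → cong (λ i → coeff q (m ∸ j) ℤ.* + d r i) (reindex j (s≤s⁻¹ j≤m))) ⟩
  ∑≤ m (λ j → coeff q (m ∸ j) ℤ.* + d r (r + (t + (m ∸ j))))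
    -- The recurrence lists coefficients from the leading one down, `apply` from the constant one
    -- up.
    ≡⟨ ∑≤-reverse m (λ i → coeff q i ℤ.* + d r (r + (t + i))) ⟩
  ∑≤ m (λ i → coeff q i ℤ.* + d r (r + (t + i)))
    ≡⟨ ∑<-coeff (suc m) q (λ i → + d r (r + (t + i))) (^ₚ-degree k) ⟩
  apply q (λ i → + d r (r + (t + i)))
    ≡⟨ apply-cong q (λ i → d-diagonal s (t + i)) ⟩
  apply q (λ i → + F (2 + (t + i)) ℤ.* S₂-offset s (t + i))
    -- `apply` evaluates at 0, so both factors are shifted by `t`; this preserves the Fibonacci rule
    -- and the degree bound.
    ≡⟨ apply-annihilates k (λ i → + F (2 + (t + i))) (shift t (S₂-offset s)) fib (Deg<-shifts t {S₂-offset s} (S₂-offset-Deg< s)) ⟩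
  0ℤ ∎
  where
  r = suc s
  k = suc (s * 2)
  m = k * 2
  q = x²-x-1 ^ₚ k
  reindex : ∀ j → j ≤ m → r + m + t ∸ j ≡ r + (t + (m ∸ j))
  reindex j j≤m = begin
    r + m + t ∸ j      ≡⟨ cong (_∸ j) (lemma r m t) ⟩
    r + t + m ∸ j      ≡⟨ +-∸-assoc (r + t) j≤m ⟩
    r + t + (m ∸ j)    ≡⟨ +-assoc r t (m ∸ j) ⟩
    r + (t + (m ∸ j))  ∎
    where
    lemma : ∀ a b c → a + b + c ≡ a + c + b
    lemma = ℕSolver.solve-∀
  fib : FibonacciLike (λ i → + F (2 + (t + i)))
  fib i rewrite +-suc t (suc i) | +-suc t i = refl
  Deg<-shifts : ∀ t {g} → Deg< k g → Deg< k (shift t g)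
  Deg<-shifts zero        dg = dg
  Deg<-shifts (suc t) {g} dg = Deg<-shifts t {g ∘ suc} (Deg<-shift k {g} dg)

theorem11 : ∀ (r : ℕ) → 1 ≤ r →
    IsCharacteristicPolynomial (x²-x-1 ^ₚ (2 * r ∸ 1)) (4 * r ∸ 2) r (λ n → + d r n)
theorem11 (suc s) _ =
  -- With r = s + 1 the exponent 2r - 1 is 2s + 1 and the degree 4r - 2 is twice that.
  subst (λ k → IsCharacteristicPolynomial (x²-x-1 ^ₚ k) (4 * suc s ∸ 2) (suc s) (λ n → + d (suc s) n))
    (sym (cong (_∸ 1) (exponent s))) $
  subst (λ m → IsCharacteristicPolynomial (x²-x-1 ^ₚ suc (s * 2)) m (suc s) (λ n → + d (suc s) n))
    (sym (cong (_∸ 2) (degree s)))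
  record
    { leading    = ^ₚ-leading (suc (s * 2))
    ; degree     = ^ₚ-degree (suc (s * 2))
    ; recurrence = d-recurrence s
    }
  where
  exponent : ∀ s → 2 * suc s ≡ 2 + s * 2
  exponent = ℕSolver.solve-∀
  degree : ∀ s → 4 * suc s ≡ 2 + suc (s * 2) * 2
  degree = ℕSolver.solve-∀
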